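{- Let $G$ be a finite simple undirected graph that contains no induced subgraph isomorphic to $P_4 \cup K_1$ and no induced subgraph isomorphic to the Kite. Then $\chi(G) \leq \left\lceil \frac{\Delta(G) + \omega(G) + 1}{2} \right\rceil$.
   Context: $\chi(G)$, $\Delta(G)$, $\omega(G)$ denote the chromatic number, maximum degree and clique number of $G$. $P_4 \cup K_1$ is the disjoint union of a path on four vertices and an isolated vertex. The Kite is the 5-vertex graph obtained from the diamond $K_4 - e$ (the complete graph on four vertices minus one edge) by adding a new vertex adjacent to exactly one of the two degree-2 vertices of the diamond; equivalently, it is the complement of the Chair. The Chair (also called fork) is the 5-vertex graph obtained from the star $K_{1,3}$ by subdividing one edge once. "Contains no induced subgraph isomorphic to $F$" means no subset of vertices of $G$ induces a graph isomorphic to $F$. -}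

module Defs where

open import Data.Bool using (Bool; true; false; _∨_; if_then_else_)
open import Data.Nat using (ℕ; zero; suc; _⊔_; _+_; _≤_; _>_; ⌈_/2⌉)
open import Data.Fin using (Fin; zero; suc)
open import Data.List using (List; allFin; map; foldr)
open import Data.Nat.ListAction using (sum)
open import Data.Product using (Σ; _×_; ∃)
open import Function.Definitions using (Injective)
open import Relation.Binary.PropositionalEquality using (_≡_; _≢_)

record Graph (n : ℕ) : Set where
  field
    adj   : Fin n → Fin n → Bool
    sym   : ∀ u v → adj u v ≡ adj v u
    irrefl : ∀ v → adj v v ≡ false
open Graph public

degree : ∀ {n} → Graph n → Fin n → ℕ
degree {n} G v = sum (map (λ u → if adj G v u then 1 else 0) (allFin n))

-- maximum degree Δ(G) (0 for the empty graph)
Δ : ∀ {n} → Graph n → ℕ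
Δ {n} G = foldr _⊔_ 0 (map (degree G) (allFin n))

HasClique : ∀ {n} → Graph n → ℕ → Set
HasClique {n} G k =
  Σ (Fin k → Fin n) λ f → Injective _≡_ _≡_ f ×
    (∀ i j → i ≢ j → adj G (f i) (f j) ≡ true)

IsCliqueNumber : ∀ {n} → Graph n → ℕ → Set
IsCliqueNumber G w = HasClique G w × (∀ k → HasClique G k → k ≤ w)

ProperColouring : ∀ {n} → Graph n → (k : ℕ) → (Fin n → Fin k) → Set
ProperColouring G k c = ∀ u v → adj G u v ≡ true → c u ≢ c v

-- χ(G) ≤ k
Colourable : ∀ {n} → Graph n → ℕ → Set
Colourable {n} G k = Σ (Fin n → Fin k) (ProperColouring G k)

-- G contains an induced subgraph isomorphic to the 5-vertex graph H
-- (H given by a Boolean adjacency on Fin 5, symmetric and irreflexive)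
InducedCopy5 : ∀ {n} → (Fin 5 → Fin 5 → Bool) → Graph n → Set
InducedCopy5 {n} H G =
  Σ (Fin 5 → Fin n) λ f → Injective _≡_ _≡_ f ×
    (∀ i j → i ≢ j → adj G (f i) (f j) ≡ H i j)

pattern v0 = zero
pattern v1 = suc zero
pattern v2 = suc (suc zero)
pattern v3 = suc (suc (suc zero))
pattern v4 = suc (suc (suc (suc zero)))

p4k1-edge : Fin 5 → Fin 5 → Bool
p4k1-edge v0 v1 = true
p4k1-edge v1 v2 = true
p4k1-edge v2 v3 = true
p4k1-edge _  _  = false

P4∪K1 : Fin 5 → Fin 5 → Bool
P4∪K1 i j = p4k1-edge i j ∨ p4k1-edge j i

-- Kite: diamond on {0,1,2,3} (K4 minus edge 2-3), plus vertex 4 adjacent to 2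
kite-edge : Fin 5 → Fin 5 → Bool
kite-edge v0 v1 = true
kite-edge v0 v2 = true
kite-edge v0 v3 = true
kite-edge v1 v2 = true
kite-edge v1 v3 = true
kite-edge v2 v4 = true
kite-edge _  _  = false

Kite : Fin 5 → Fin 5 → Bool
Kite i j = kite-edge i j ∨ kite-edge j i

{-# OPTIONS --safe #-}
module Submission where

open import Defs
open import Data.Bool using (Bool; true; false; if_then_else_)
open import Data.Bool.Properties using () renaming (_≟_ to _≟ᵇ_)
open import Data.Empty using (⊥; ⊥-elim)
open import Data.Fin using (Fin; zero; suc; inject≤)
open import Data.Fin.Properties using (all?; any?; inject≤-injective) renaming (_≟_ to _≟ᶠ_)
open import Data.List using (List; []; _∷_; map; foldr; length; filter; lookup; allFin; _++_)
open import Data.List.Membership.DecPropositional using () renaming (_∈?_ to member?)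
open import Data.List.Membership.Propositional using (_∈_; _∉_; find)
open import Data.List.Membership.Propositional.Properties using (∈-filter⁺; ∈-filter⁻; ∈-allFin; ∈-lookup; ∈-∃++; ∈-AllPairs₂; ∈-++⁺ˡ; ∈-++⁺ʳ; ∈-++⁻)
open import Data.List.Relation.Binary.Permutation.Propositional using (_↭_; prep; ↭-refl; ↭-sym; ↭-trans; ↭⇒↭ₛ)
open import Data.List.Relation.Binary.Permutation.Propositional.Properties using (shift; ++⁺ˡ; ∈-resp-↭; ↭-length)
open import Data.List.Relation.Binary.Permutation.Setoid.Properties using (AllPairs-resp-↭)
open import Data.List.Relation.Binary.Subset.Propositional using (_⊆_)
open import Data.List.Relation.Binary.Subset.Propositional.Properties using (∈-∷⁺ʳ)
open import Data.List.Relation.Unary.All as All using (All; []; _∷_)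
open import Data.List.Relation.Unary.AllPairs as AllPairs using (AllPairs; []; _∷_)
import Data.List.Relation.Unary.AllPairs.Properties as AllPairs
open import Data.List.Relation.Unary.Any as Any using (Any; here; there)
open import Data.List.Relation.Unary.Any.Properties using (lookup-index)
open import Data.List.Relation.Unary.Unique.Propositional using (Unique)
open import Data.Nat using (ℕ; zero; suc; _+_; _≤_; _<_; z≤n; s≤s; s≤s⁻¹; ⌈_/2⌉; ⌊_/2⌋; _⊔_)
open import Data.Nat.ListAction using (sum)
open import Data.Nat.Properties
open import Data.Nat.Solver using (module +-*-Solver)
open import Data.Product using (Σ; ∃; _×_; _,_; proj₁; proj₂)
open import Data.Sum as Sum using (_⊎_; inj₁; inj₂)
open import Function using (_∘_)
open import Function.Definitions using (Injective)
open import Relation.Binary.PropositionalEquality using (_≡_; _≢_; refl; trans; cong; subst; setoid) renaming (sym to ≡-sym)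
open import Relation.Nullary using (¬_; Dec; yes; no)
open import Relation.Nullary.Decidable using (from-yes; _⊎-dec_; _×-dec_; ¬?)
open import Relation.Unary using (Decidable)

-- Induction on ω.  Fix a vertex x, a maximal stable set S containing x, and let A be the
-- non-neighbourhood of x, which is P₄-free.  If S meets every ω-clique, delete it: both Δ and ω drop.
-- Otherwise some ω-clique K avoids S.  By P₄-freeness every clique of A ∖ S has a common neighbour
-- in S; if |K ∩ A| ≥ 2, Kite-freeness lets that neighbour extend K.  So K ∩ A is a single vertex a, and
-- a triangle in A would again produce a clique larger than ω.  Hence A ∖ S is stable, and it remains
-- to colour N(x): pair up non-adjacent vertices until a clique L is left.  This uses
-- 2 + (|N(x)| + |L|)/2 colours, which is sufficient unless |L| = ω − 1; in that case one pair can be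
-- merged with L to save a colour, or, if there is no pair, Δ ≥ ω since each vertex of K ∖ {a} is
-- adjacent to x as well as to the rest of K.

-- Lists: removing a member, counting and filtering.

module _ {A : Set} where

  ∈⇒↭∷ : ∀ {v : A} {xs} → v ∈ xs → ∃ λ ys → xs ↭ v ∷ ys
  ∈⇒↭∷ {v} v∈xs with ∈-∃++ v∈xs
  ... | ys , zs , refl = _ , shift v ys zs

  unique-⊆⇒length≤ : ∀ {xs ys : List A} → Unique xs → xs ⊆ ys → length xs ≤ length ys
  unique-⊆⇒length≤ {[]} _ _ = z≤n
  unique-⊆⇒length≤ {x ∷ xs} {ys} (x∉ ∷ u) sub with ∈⇒↭∷ (sub (here refl))
  ... | zs , ys↭ = subst (suc (length xs) ≤_) (≡-sym (↭-length ys↭)) (s≤s (unique-⊆⇒length≤ u sub′))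
    where
    sub′ : xs ⊆ zs
    sub′ {v} v∈xs with ∈-resp-↭ ys↭ (sub (there v∈xs))
    ... | here refl = ⊥-elim (All.lookup x∉ v∈xs refl)
    ... | there v∈zs = v∈zs

  length-filter-filter≤ : ∀ {P Q : A → Set} (P? : Decidable P) (Q? : Decidable Q) xs →
    length (filter P? (filter Q? xs)) ≤ length (filter P? xs)
  length-filter-filter≤ P? Q? [] = z≤n
  length-filter-filter≤ P? Q? (x ∷ xs) with length-filter-filter≤ P? Q? xs | Q? x
  ... | ih | yes _ with P? x
  ...   | yes _ = s≤s ih
  ...   | no _ = ih
  length-filter-filter≤ P? Q? (x ∷ xs) | ih | no _ with P? x
  ...   | yes _ = m≤n⇒m≤1+n ih
  ...   | no _ = ih

  -- This serves degrees: with `P` adjacency to a fixed vertex and `Q` survival of a deletion, one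
  -- deleted neighbour `v` already makes the degree drop.
  length-filter-filter< : ∀ {P Q : A → Set} (P? : Decidable P) (Q? : Decidable Q) {v xs} →
    v ∈ xs → P v → ¬ Q v → length (filter P? (filter Q? xs)) < length (filter P? xs)
  length-filter-filter< P? Q? {v} {x ∷ xs} (here refl) Pv ¬Qv with Q? v
  ... | yes Qv = ⊥-elim (¬Qv Qv)
  ... | no _ with P? v
  ...   | yes _ = s≤s (length-filter-filter≤ P? Q? xs)
  ...   | no ¬Pv = ⊥-elim (¬Pv Pv)
  length-filter-filter< P? Q? {v} {x ∷ xs} (there v∈) Pv ¬Qv
    with length-filter-filter< P? Q? v∈ Pv ¬Qv | Q? x
  ... | ih | yes _ with P? x
  ...   | yes _ = s≤s ih
  ...   | no _ = ih
  length-filter-filter< P? Q? {v} {x ∷ xs} (there v∈) Pv ¬Qv | ih | no _ with P? x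
  ...   | yes _ = m≤n⇒m≤1+n ih
  ...   | no _ = ih

  ≤-foldr-⊔ : ∀ (f : A → ℕ) {v xs} → v ∈ xs → f v ≤ foldr _⊔_ 0 (map f xs)
  ≤-foldr-⊔ f (here refl) = m≤m⊔n _ _
  ≤-foldr-⊔ f (there v∈) = ≤-trans (≤-foldr-⊔ f v∈) (m≤n⊔m _ _)

  lookup-AllPairs : ∀ {R : A → A → Set} → (∀ {u v} → R u v → R v u) → ∀ {xs} → AllPairs R xs →
    ∀ i j → i ≢ j → R (lookup xs i) (lookup xs j)
  lookup-AllPairs s (r ∷ rs) zero zero i≢j = ⊥-elim (i≢j refl)
  lookup-AllPairs s (r ∷ rs) zero (suc j) _ = All.lookup r (∈-lookup j)
  lookup-AllPairs s (r ∷ rs) (suc i) zero _ = s (All.lookup r (∈-lookup i))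
  lookup-AllPairs s (r ∷ rs) (suc i) (suc j) i≢j = lookup-AllPairs s rs i j (i≢j ∘ cong suc)

-- Any two vertices are adjacent or told apart by a third one, so a copy of H is automatically injective.
Separated : (Fin 5 → Fin 5 → Bool) → Set
Separated H = ∀ i j → i ≡ j ⊎ H i j ≡ true ⊎ ∃ λ k → i ≢ k × j ≢ k × H i k ≢ H j k

separated? : ∀ H → Dec (Separated H)
separated? H = all? λ i → all? λ j → (i ≟ᶠ j) ⊎-dec (H i j ≟ᵇ true) ⊎-dec
  any? λ k → ¬? (i ≟ᶠ k) ×-dec ¬? (j ≟ᶠ k) ×-dec ¬? (H i k ≟ᵇ H j k)

-- Adjacency, and induced copies of the two forbidden graphs.

module _ {n} (G : Graph n) where

  V : Set
  V = Fin n

  infix 4 _~_ _≁_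
  _~_ _≁_ : V → V → Set
  u ~ v = adj G u v ≡ true
  u ≁ v = adj G u v ≡ false

  ~-sym : ∀ {u v} → u ~ v → v ~ u
  ~-sym {u} {v} = trans (Graph.sym G v u)

  ≁-sym : ∀ {u v} → u ≁ v → v ≁ u
  ≁-sym {u} {v} = trans (Graph.sym G v u)

  ≁-refl : ∀ {v} → v ≁ v
  ≁-refl {v} = irrefl G v

  ~×≁⇒⊥ : ∀ {u v} → u ~ v → u ≁ v → ⊥
  ~×≁⇒⊥ p q with trans (≡-sym p) q
  ... | ()

  ~⊎≁ : ∀ u v → u ~ v ⊎ u ≁ v
  ~⊎≁ u v with adj G u v
  ... | true = inj₁ refl
  ... | false = inj₂ refl

  ~-byContradiction : ∀ {u v} → (u ≁ v → ⊥) → u ~ v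
  ~-byContradiction {u} {v} h with ~⊎≁ u v
  ... | inj₁ p = p
  ... | inj₂ q = ⊥-elim (h q)

  ~⇒≢ : ∀ {u v} → u ~ v → u ≢ v
  ~⇒≢ u~v refl = ~×≁⇒⊥ u~v ≁-refl

  infix 4 _~?_ _≁?_ _∈?_ _∉?_
  _~?_ : ∀ u v → Dec (u ~ v)
  u ~? v = adj G u v ≟ᵇ true

  _≁?_ : ∀ u v → Dec (u ≁ v)
  u ≁? v = adj G u v ≟ᵇ false

  _∈?_ : (v : V) (xs : List V) → Dec (v ∈ xs)
  _∈?_ = member? _≟ᶠ_

  copy5 : ∀ {H} → Separated H → (f : Fin 5 → V) →
    (∀ i j → i ≢ j → adj G (f i) (f j) ≡ H i j) → InducedCopy5 H G
  copy5 {H} sep f e = f , inj , e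
    where
    inj : Injective _≡_ _≡_ f
    inj {i} {j} fi≡fj with i ≟ᶠ j
    ... | yes i≡j = i≡j
    ... | no i≢j with sep i j
    ...   | inj₁ i≡j = i≡j
    ...   | inj₂ (inj₁ Hij) =
              ⊥-elim (~⇒≢ (trans (e i j i≢j) Hij) fi≡fj)
    ...   | inj₂ (inj₂ (k , i≢k , j≢k , Hik≢Hjk)) =
              ⊥-elim (Hik≢Hjk (trans (≡-sym (e i k i≢k)) (trans (cong (λ v → adj G v (f k)) fi≡fj) (e j k j≢k))))

  five : V → V → V → V → V → Fin 5 → V
  five p q r s t v0 = p
  five p q r s t v1 = q
  five p q r s t v2 = r
  five p q r s t v3 = s
  five p q r s t v4 = t

  mk-P4∪K1 : ∀ p q r s t → p ~ q → q ~ r → r ~ s → p ≁ r → p ≁ s → q ≁ s →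
    t ≁ p → t ≁ q → t ≁ r → t ≁ s → InducedCopy5 P4∪K1 G
  mk-P4∪K1 p q r s t pq qr rs pr ps qs tp tq tr ts =
    copy5 (from-yes (separated? P4∪K1)) (five p q r s t) e
    where
    e : ∀ i j → i ≢ j → adj G (five p q r s t i) (five p q r s t j) ≡ P4∪K1 i j
    e v0 v0 ne = ⊥-elim (ne refl)
    e v0 v1 _ = pq
    e v0 v2 _ = pr
    e v0 v3 _ = ps
    e v0 v4 _ = ≁-sym tp
    e v1 v0 _ = ~-sym pq
    e v1 v1 ne = ⊥-elim (ne refl)
    e v1 v2 _ = qr
    e v1 v3 _ = qs
    e v1 v4 _ = ≁-sym tq
    e v2 v0 _ = ≁-sym pr
    e v2 v1 _ = ~-sym qr
    e v2 v2 ne = ⊥-elim (ne refl)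
    e v2 v3 _ = rs
    e v2 v4 _ = ≁-sym tr
    e v3 v0 _ = ≁-sym ps
    e v3 v1 _ = ≁-sym qs
    e v3 v2 _ = ~-sym rs
    e v3 v3 ne = ⊥-elim (ne refl)
    e v3 v4 _ = ≁-sym ts
    e v4 v0 _ = tp
    e v4 v1 _ = tq
    e v4 v2 _ = tr
    e v4 v3 _ = ts
    e v4 v4 ne = ⊥-elim (ne refl)

  -- p, q are the centres of the diamond, r, s its ends, and t hangs on r.
  mk-Kite : ∀ p q r s t → p ~ q → p ~ r → p ~ s → q ~ r → q ~ s → r ~ t →
    r ≁ s → p ≁ t → q ≁ t → s ≁ t → InducedCopy5 Kite G
  mk-Kite p q r s t pq pr ps qr qs rt rs pt qt st =
    copy5 (from-yes (separated? Kite)) (five p q r s t) e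
    where
    e : ∀ i j → i ≢ j → adj G (five p q r s t i) (five p q r s t j) ≡ Kite i j
    e v0 v0 ne = ⊥-elim (ne refl)
    e v0 v1 _ = pq
    e v0 v2 _ = pr
    e v0 v3 _ = ps
    e v0 v4 _ = pt
    e v1 v0 _ = ~-sym pq
    e v1 v1 ne = ⊥-elim (ne refl)
    e v1 v2 _ = qr
    e v1 v3 _ = qs
    e v1 v4 _ = qt
    e v2 v0 _ = ~-sym pr
    e v2 v1 _ = ~-sym qr
    e v2 v2 ne = ⊥-elim (ne refl)
    e v2 v3 _ = rs
    e v2 v4 _ = rt
    e v3 v0 _ = ~-sym ps
    e v3 v1 _ = ~-sym qs
    e v3 v2 _ = ≁-sym rs
    e v3 v3 ne = ⊥-elim (ne refl)
    e v3 v4 _ = st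
    e v4 v0 _ = ≁-sym pt
    e v4 v1 _ = ≁-sym qt
    e v4 v2 _ = ~-sym rt
    e v4 v3 _ = ≁-sym st
    e v4 v4 ne = ⊥-elim (ne refl)

  -- Cliques, stable sets and covers inside a list of vertices.

  Clique : List V → Set
  Clique = AllPairs _~_

  -- A `Clique` list has no repetitions, since no vertex is adjacent to itself, so its length is its
  -- size. Stability speaks of membership only, so a class may list a vertex twice.
  Stable : List V → Set
  Stable S = ∀ {u v} → u ∈ S → v ∈ S → u ≁ v

  -- `U` stands for the subgraph it induces, so that the induction deletes vertices without building
  -- new graphs.
  CliqueBound DegreeBound : List V → ℕ → Set
  CliqueBound U w = ∀ Q → Clique Q → Q ⊆ U → length Q ≤ w
  DegreeBound U d = ∀ {v} → v ∈ U → length (filter (v ~?_) U) ≤ d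

  -- Colour classes may overlap or be empty, which makes them easy to merge and extend; a genuine
  -- colouring is extracted only at the end.
  StableCover : List V → ℕ → Set
  StableCover U k = Σ (List (List V)) λ Cs →
    length Cs ≡ k × All Stable Cs × (∀ {v} → v ∈ U → Any (v ∈_) Cs)

  all~⊎some≁ : ∀ v xs → All (v ~_) xs ⊎ ∃ λ u → u ∈ xs × v ≁ u
  all~⊎some≁ v xs = Sum.map₂ find (All.decide (~⊎≁ v) xs)

  all≁⊎some~ : ∀ v xs → All (v ≁_) xs ⊎ ∃ λ u → u ∈ xs × v ~ u
  all≁⊎some~ v xs = Sum.map₂ find (All.decide (Sum.swap ∘ ~⊎≁ v) xs)

  clique-adjacent : ∀ {Q u v} → Clique Q → u ∈ Q → v ∈ Q → u ≢ v → u ~ v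
  clique-adjacent cl u∈ v∈ u≢v with ∈-AllPairs₂ cl u∈ v∈
  ... | inj₁ u≡v = ⊥-elim (u≢v u≡v)
  ... | inj₂ (inj₁ u~v) = u~v
  ... | inj₂ (inj₂ v~u) = ~-sym v~u

  clique-extract : ∀ {Q v} → Clique Q → v ∈ Q → ∃ λ R → Q ↭ v ∷ R × All (v ~_) R × Clique R
  clique-extract cl v∈ with ∈⇒↭∷ v∈
  ... | R , Q↭ with AllPairs-resp-↭ (setoid V) ~-sym ((λ { refl p → p }) , (λ { refl p → p })) (↭⇒↭ₛ Q↭) cl
  ...   | v~R ∷ clR = R , Q↭ , v~R , clR

  -- A clique in `v ∷ L` either avoids `v` or is `v` together with a clique one smaller among the
  -- neighbours of `v` in `L`. Run on `U ∖ S`, the search decides whether `S` meets every maximum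
  -- clique, and its negative answer is a clique bound for the remainder.
  cliqueOfSize? : ∀ k L → (∃ λ Q → Clique Q × Q ⊆ L × length Q ≡ k) ⊎
    (∀ Q → Clique Q → Q ⊆ L → length Q < k)
  cliqueOfSize? zero L = inj₁ ([] , [] , (λ ()) , refl)
  cliqueOfSize? (suc k) [] = inj₂ λ
    { [] _ _ → s≤s z≤n
    ; (q ∷ Q) _ sub → ⊥-elim (¬∈[] (sub (here refl))) }
    where
    ¬∈[] : ∀ {v : V} → v ∈ [] → ⊥
    ¬∈[] ()
  cliqueOfSize? (suc k) (v ∷ L) with cliqueOfSize? (suc k) L
  ... | inj₁ (Q , cl , sub , len) = inj₁ (Q , cl , there ∘ sub , len)
  ... | inj₂ none with cliqueOfSize? k (filter (v ~?_) L)
  ...   | inj₁ (Q , cl , sub , len) = inj₁ (v ∷ Q , All.tabulate (proj₂ ∘ f) ∷ cl , ∈-∷⁺ʳ (here refl) (there ∘ proj₁ ∘ f) , cong suc len)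
    where
    f : ∀ {u} → u ∈ Q → u ∈ L × v ~ u
    f u∈ = ∈-filter⁻ (v ~?_) (sub u∈)
  ...   | inj₂ none′ = inj₂ bound
    where
    drop-v : ∀ {u} → u ∈ v ∷ L → u ≢ v → u ∈ L
    drop-v (here u≡v) u≢v = ⊥-elim (u≢v u≡v)
    drop-v (there u∈) _ = u∈
    bound : ∀ Q → Clique Q → Q ⊆ v ∷ L → length Q < suc k
    bound Q cl sub with v ∈? Q
    ... | no v∉Q = none Q cl λ u∈ → drop-v (sub u∈) λ { refl → v∉Q u∈ }
    ... | yes v∈Q with clique-extract cl v∈Q
    ...   | R , Q↭ , v~R , clR = subst (_< suc k) (≡-sym (↭-length Q↭)) (s≤s (none′ R clR λ u∈ →
            ∈-filter⁺ (v ~?_) (drop-v (sub (∈-resp-↭ (↭-sym Q↭) (there u∈))) (~⇒≢ (All.lookup v~R u∈) ∘ ≡-sym)) (All.lookup v~R u∈)))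

  -- Deletion of a set, and maximal stable sets.

  _∉?_ : (v : V) (xs : List V) → Dec (v ∉ xs)
  v ∉? xs = ¬? (v ∈? xs)

  infixl 5 _∖_
  _∖_ : List V → List V → List V
  U ∖ S = filter (_∉? S) U

  ∈∖⁻ : ∀ U S {v} → v ∈ U ∖ S → v ∈ U × v ∉ S
  ∈∖⁻ U S = ∈-filter⁻ (_∉? S) {xs = U}

  ∈⇒∈⊎∈∖ : ∀ {U v} S → v ∈ U → v ∈ S ⊎ v ∈ U ∖ S
  ∈⇒∈⊎∈∖ {v = v} S v∈U with v ∈? S
  ... | yes v∈S = inj₁ v∈S
  ... | no v∉S = inj₂ (∈-filter⁺ (_∉? S) v∈U v∉S)

  Dominates : List V → List V → Set
  Dominates S U = ∀ {u} → u ∈ U → u ∉ S → ∃ λ s → s ∈ S × u ~ s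

  -- Greedy choice with `x` as the seed: a vertex joins unless it has a neighbour in the set so far,
  -- and that neighbour then witnesses domination.
  maximalStable : ∀ x U → ∃ λ S → x ∈ S × S ⊆ x ∷ U × Stable S × Dominates S U
  maximalStable x [] = x ∷ [] , here refl , (λ v∈ → v∈) ,
    (λ { (here refl) (here refl) → ≁-refl }) , λ ()
  maximalStable x (v ∷ U) with maximalStable x U
  ... | S , x∈S , sub , st , dom with all≁⊎some~ v S
  ...   | inj₂ (s , s∈ , v~s) = S , x∈S , weaken ∘ sub , st ,
            λ { (here refl) _ → s , s∈ , v~s ; (there u∈) u∉ → dom u∈ u∉ }
    where
    weaken : ∀ {u} → u ∈ x ∷ U → u ∈ x ∷ v ∷ U
    weaken (here p) = here p
    weaken (there p) = there (there p)
  ...   | inj₁ v≁S = v ∷ S , there x∈S , sub′ , st′ ,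
            λ { (here refl) v∉ → ⊥-elim (v∉ (here refl))
              ; (there u∈) u∉ → let s , s∈ , u~s = dom u∈ (u∉ ∘ there) in s , there s∈ , u~s }
    where
    sub′ : v ∷ S ⊆ x ∷ v ∷ U
    sub′ (here p) = there (here p)
    sub′ (there p) with sub p
    ... | here q = here q
    ... | there q = there (there q)
    st′ : Stable (v ∷ S)
    st′ (here refl) (here refl) = ≁-refl
    st′ (here refl) (there q) = All.lookup v≁S q
    st′ (there p) (here refl) = ≁-sym (All.lookup v≁S p)
    st′ (there p) (there q) = st p q

  ≁-byContradiction : ∀ {u v} → (u ~ v → ⊥) → u ≁ v
  ≁-byContradiction {u} {v} h with ~⊎≁ u v
  ... | inj₁ p = ⊥-elim (h p)
  ... | inj₂ q = q

  -- Building covers by stable sets.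

  stable-pair : ∀ {u v} → u ≁ v → Stable (u ∷ v ∷ [])
  stable-pair u≁v (here refl) (here refl) = ≁-refl
  stable-pair u≁v (here refl) (there (here refl)) = u≁v
  stable-pair u≁v (there (here refl)) (here refl) = ≁-sym u≁v
  stable-pair u≁v (there (here refl)) (there (here refl)) = ≁-refl

  stable-triple : ∀ {u v k} → u ≁ v → u ≁ k → v ≁ k → Stable (u ∷ v ∷ k ∷ [])
  stable-triple u≁v u≁k v≁k (here refl) (here refl) = ≁-refl
  stable-triple u≁v u≁k v≁k (here refl) (there (here refl)) = u≁v
  stable-triple u≁v u≁k v≁k (here refl) (there (there (here refl))) = u≁k
  stable-triple u≁v u≁k v≁k (there (here refl)) (here refl) = ≁-sym u≁v
  stable-triple u≁v u≁k v≁k (there (there (here refl))) (here refl) = ≁-sym u≁k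
  stable-triple u≁v u≁k v≁k (there p) (there q) = stable-pair v≁k p q

  cover-∷ : ∀ {C U U′ k} → Stable C → (∀ {v} → v ∈ U′ → v ∈ C ⊎ v ∈ U) →
    StableCover U k → StableCover U′ (suc k)
  cover-∷ {C} st split (Cs , len , sts , cov) = C ∷ Cs , cong suc len , (λ {u} {v} → st {u} {v}) ∷ sts , cov′
    where
    cov′ : ∀ {v} → v ∈ _ → Any (v ∈_) (C ∷ Cs)
    cov′ v∈ with split v∈
    ... | inj₁ v∈C = here v∈C
    ... | inj₂ v∈U = there (cov v∈U)

  cover-⊆ : ∀ {U U′ k} → U′ ⊆ U → StableCover U k → StableCover U′ k
  cover-⊆ sub (Cs , len , sts , cov) = Cs , len , sts , cov ∘ sub

  cover-[] : StableCover [] 0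
  cover-[] = [] , refl , [] , λ ()

  cover-singletons : ∀ L → StableCover L (length L)
  cover-singletons [] = cover-[]
  cover-singletons (v ∷ L) = cover-∷ {v ∷ []} (λ { (here refl) (here refl) → ≁-refl })
    (λ { (here p) → inj₁ (here p) ; (there p) → inj₂ p }) (cover-singletons L)

  -- Covering a neighbourhood by pairing off non-adjacent vertices.

  ends : List (V × V) → List V
  ends [] = []
  ends ((u , v) ∷ P) = u ∷ v ∷ ends P

  length-ends : ∀ P L → length (ends P ++ L) ≡ (length P + length P) + length L
  length-ends [] L = refl
  length-ends (_ ∷ P) L = cong suc (trans (cong suc (length-ends P L))
    (≡-sym (cong (_+ length L) (+-suc (length P) (length P)))))

  NonAdjacentPair : V × V → Set
  NonAdjacentPair (u , v) = u ≁ v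

  cover-pairs : ∀ {P U k} → All NonAdjacentPair P → StableCover U k → StableCover (ends P ++ U) (length P + k)
  cover-pairs [] c = c
  cover-pairs {(u , v) ∷ P} (u≁v ∷ ne) c = cover-∷ (stable-pair u≁v)
    (λ { (here p) → inj₁ (here p) ; (there (here p)) → inj₁ (there (here p)) ; (there (there p)) → inj₂ p })
    (cover-pairs ne c)

  -- The unpaired vertices are kept a clique: a new vertex complete to `L` joins it, and otherwise
  -- it is paired with a vertex of `L` that it misses.
  pairing : ∀ N → ∃ λ P → ∃ λ L → All NonAdjacentPair P × Clique L × N ↭ ends P ++ L
  pairing [] = [] , [] , [] , [] , ↭-refl
  pairing (v ∷ N) with pairing N
  ... | P , L , ne , cl , N↭ with all~⊎some≁ v L
  ...   | inj₁ v~L = P , v ∷ L , ne , v~L ∷ cl , ↭-trans (prep v N↭) (↭-sym (shift v (ends P) L))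
  ...   | inj₂ (u , u∈L , v≁u) with clique-extract cl u∈L
  ...     | R , L↭ , _ , clR = (v , u) ∷ P , R , v≁u ∷ ne , clR ,
              prep v (↭-trans N↭ (↭-trans (++⁺ˡ (ends P) L↭) (shift u (ends P) R)))

  ↭∷-split : ∀ {v k : V} {L R} → L ↭ k ∷ R → v ∈ L → v ≡ k ⊎ v ∈ R
  ↭∷-split L↭ v∈ with ∈-resp-↭ L↭ v∈
  ... | here p = inj₁ p
  ... | there p = inj₂ p

  -- The pair `u`, `v` is absorbed without a colour beyond those of `L`. If `v` misses `k` too, both
  -- join `k`; otherwise `l` is not `k`, and `u` joins `k` while `v` joins `l`.
  cover-augmented : ∀ {u v k l} L → u ≁ v → k ∈ L → u ≁ k → l ∈ L → v ≁ l →
    StableCover (u ∷ v ∷ L) (length L)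
  cover-augmented {u} {v} {k} {l} L u≁v k∈ u≁k l∈ v≁l with ∈⇒↭∷ k∈
  ... | R , L↭ with ~⊎≁ v k
  ...   | inj₂ v≁k = subst (StableCover _) (≡-sym (↭-length L↭))
            (cover-∷ {u ∷ v ∷ k ∷ []} (stable-triple u≁v u≁k v≁k) split (cover-singletons R))
    where
    split : ∀ {y} → y ∈ u ∷ v ∷ L → y ∈ u ∷ v ∷ k ∷ [] ⊎ y ∈ R
    split (here p) = inj₁ (here p)
    split (there (here p)) = inj₁ (there (here p))
    split (there (there p)) = Sum.map₁ (λ q → there (there (here q))) (↭∷-split L↭ p)
  ...   | inj₁ v~k with ↭∷-split L↭ l∈
  ...     | inj₁ refl = ⊥-elim (~×≁⇒⊥ v~k v≁l)
  ...     | inj₂ l∈R with ∈⇒↭∷ l∈R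
  ...       | R′ , R↭ = subst (StableCover _) (≡-sym (trans (↭-length L↭) (cong suc (↭-length R↭))))
                (cover-∷ {u ∷ k ∷ []} {v ∷ R} (stable-pair u≁k) split
                  (cover-∷ {v ∷ l ∷ []} (stable-pair v≁l) split′ (cover-singletons R′)))
    where
    split : ∀ {y} → y ∈ u ∷ v ∷ L → y ∈ u ∷ k ∷ [] ⊎ y ∈ v ∷ R
    split (here p) = inj₁ (here p)
    split (there (here p)) = inj₂ (here p)
    split (there (there p)) = Sum.map (λ q → there (here q)) there (↭∷-split L↭ p)
    split′ : ∀ {y} → y ∈ v ∷ R → y ∈ v ∷ l ∷ [] ⊎ y ∈ R′
    split′ (here p) = inj₁ (here p)
    split′ (there p) = Sum.map₁ (λ q → there (here q)) (↭∷-split R↭ p)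

  cover-neighbourhood : ∀ {U x w d} → CliqueBound U (suc w) → x ∈ U →
    (let N = filter (x ~?_) U) → length N ≤ d → w < d →
    ∃ λ k → StableCover N k × suc (k + k) ≤ d + w
  cover-neighbourhood {U} {x} {w} {d} cb x∈U |N|≤d w<d with pairing (filter (x ~?_) U)
  ... | P , L , ne , cl , N↭ = go P ne N↭
    where
    N = filter (x ~?_) U

    module _ (P : List (V × V)) (N↭ : N ↭ ends P ++ L) where

      nbr : ∀ {v} → v ∈ ends P ++ L → v ∈ U × x ~ v
      nbr v∈ = ∈-filter⁻ (x ~?_) (∈-resp-↭ (↭-sym N↭) v∈)

      nbrL : ∀ {v} → v ∈ L → v ∈ U × x ~ v
      nbrL = nbr ∘ ∈-++⁺ʳ (ends P)

      x∷L-clique : Clique (x ∷ L)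
      x∷L-clique = All.tabulate (proj₂ ∘ nbrL) ∷ cl

      x∷L⊆U : x ∷ L ⊆ U
      x∷L⊆U = ∈-∷⁺ʳ x∈U (proj₁ ∘ nbrL)

      |L|≤w : length L ≤ w
      |L|≤w = s≤s⁻¹ (cb (x ∷ L) x∷L-clique x∷L⊆U)

      missed : w ≤ length L → ∀ {v} → v ∈ ends P ++ L → ∃ λ k → k ∈ L × v ≁ k
      missed w≤ {v} v∈ with all~⊎some≁ v L
      ... | inj₂ r = r
      -- A neighbour of `x` complete to `L` would form with `x` and `L` a clique of size at least
      -- `w + 2`.
      ... | inj₁ v~L = ⊥-elim (1+n≰n (≤-trans (s≤s (s≤s w≤))
              (cb (v ∷ x ∷ L) ((~-sym (proj₂ (nbr v∈)) ∷ v~L) ∷ x∷L-clique) (∈-∷⁺ʳ (proj₁ (nbr v∈)) x∷L⊆U))))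

      count : (length P + length P) + length L ≤ d
      count = subst (_≤ d) (trans (↭-length N↭) (length-ends P L)) |N|≤d

    -- With `p` pairs and `l` vertices left over, the number of colours is `p + l`. The regrouping
    -- isolates the size `2p + l` of the neighbourhood, bounded by `d`, leaving `l + 1` to compare
    -- with `w`.
    suc-double-+ : ∀ p l → suc ((p + l) + (p + l)) ≡ ((p + p) + l) + suc l
    suc-double-+ = solve 2 (λ p l → con 1 :+ ((p :+ l) :+ (p :+ l)) := ((p :+ p) :+ l) :+ (con 1 :+ l)) refl
      where open +-*-Solver

    go : ∀ P → All NonAdjacentPair P → N ↭ ends P ++ L →
      ∃ λ k → StableCover N k × suc (k + k) ≤ d + w
    -- Without pairs there is nothing to merge; the missing unit comes from `w < d`.
    go [] _ N↭ = length L , cover-⊆ (∈-resp-↭ N↭) (cover-singletons L) ,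
      +-mono-≤ (≤-trans (s≤s (|L|≤w [] N↭)) w<d) (|L|≤w [] N↭)
    go P@((u , v) ∷ P′) ne@(u≁v ∷ ne′) N↭ with w ≤? length L
    ... | no w≰ = length P + length L ,
            cover-⊆ (∈-resp-↭ N↭) (cover-pairs ne (cover-singletons L)) ,
            subst (_≤ d + w) (≡-sym (suc-double-+ (length P) (length L))) (+-mono-≤ (count P N↭) (≰⇒> w≰))
    ... | yes w≤ with missed P N↭ w≤ (here refl) | missed P N↭ w≤ (there (here refl))
    -- Here `L` has size `w`, so both members of the first pair miss a vertex of `L` and can be
    -- absorbed. Saving that colour lowers the doubled count by two, enough to offset the surplus
    -- unit.
    ...   | k , k∈ , u≁k | l , l∈ , v≁l = length P′ + length L ,
              cover-⊆ reorder (cover-pairs ne′ (cover-augmented L u≁v k∈ u≁k l∈ v≁l)) ,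
              subst (_≤ d + w) (≡-sym (suc-double-+ (length P′) (length L)))
                (≤-trans (≤-trans (≤-reflexive (+-suc _ (length L))) (+-monoˡ-≤ (length L)
                  (s≤s (+-monoˡ-≤ (length L) (+-monoʳ-≤ (length P′) (n≤1+n _))))))
                  (+-mono-≤ (count P N↭) (|L|≤w P N↭)))
      where
      reorder : N ⊆ ends P′ ++ u ∷ v ∷ L
      reorder y∈ with ∈-resp-↭ N↭ y∈
      ... | here p = ∈-++⁺ʳ (ends P′) (here p)
      ... | there (here p) = ∈-++⁺ʳ (ends P′) (there (here p))
      ... | there (there p) with ∈-++⁻ (ends P′) p
      ...   | inj₁ q = ∈-++⁺ˡ q
      ...   | inj₂ q = ∈-++⁺ʳ (ends P′) (there (there q))

  -- Consequences of the forbidden subgraphs: common neighbours and exchangeable cliques.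

  module _ (p4∪k1-free : ¬ InducedCopy5 P4∪K1 G) (kite-free : ¬ InducedCopy5 Kite G) where

    -- Induction on the clique. If the vertex `s` found for the tail misses `q`, a neighbour `s′` of
    -- `q` in `S` takes over: were it to miss `q′` in the tail, the path `s`, `q′`, `q`, `s′` would
    -- be induced, with `x` isolated from it.
    common-neighbour : ∀ {U S x} → x ∈ S → Stable S → Dominates S U →
      ∀ Q → Clique Q → Q ⊆ U → All (x ≁_) Q → All (_∉ S) Q → ∃ λ s → s ∈ S × All (s ~_) Q
    common-neighbour {x = x} x∈S st dom [] _ _ _ _ = x , x∈S , []
    common-neighbour {x = x} x∈S st dom (q ∷ Q) (q~Q ∷ cl) Q⊆U (x≁q ∷ x≁Q) (q∉S ∷ Q∉S)
      with common-neighbour x∈S st dom Q cl (Q⊆U ∘ there) x≁Q Q∉S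
    ... | s , s∈S , s~Q with ~⊎≁ s q
    ...   | inj₁ s~q = s , s∈S , s~q ∷ s~Q
    ...   | inj₂ s≁q with dom (Q⊆U (here refl)) q∉S
    ...     | s′ , s′∈S , q~s′ with all~⊎some≁ s′ Q
    ...       | inj₁ s′~Q = s′ , s′∈S , ~-sym q~s′ ∷ s′~Q
    ...       | inj₂ (q′ , q′∈Q , s′≁q′) = ⊥-elim (p4∪k1-free (mk-P4∪K1 s q′ q s′ x
                  (All.lookup s~Q q′∈Q) (~-sym (All.lookup q~Q q′∈Q)) q~s′
                  s≁q (st s∈S s′∈S) (≁-sym s′≁q′)
                  (st x∈S s∈S) (All.lookup x≁Q q′∈Q) x≁q (st x∈S s′∈S)))

    -- Both x ∷ K and a ∷ K are maximum cliques.
    module ExchangeableClique {U w} (cb : CliqueBound U (suc w)) {x a K}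
      (x≁a : x ≁ a) (a∈U : a ∈ U)
      (clK : Clique K) (K⊆U : K ⊆ U) (|K|≡w : length K ≡ w)
      (x~K : All (x ~_) K) (a~K : All (a ~_) K) where

      too-large : ∀ Q → Clique Q → Q ⊆ U → length Q ≡ suc (suc w) → ⊥
      too-large Q cl Q⊆U len = 1+n≰n (subst (_≤ suc w) len (cb Q cl Q⊆U))

      module _ {b} (b∈U : b ∈ U) (x≁b : x ≁ b) (a~b : a ~ b) where

        record MissedOnce : Set where
          field
            y : V
            K′ : List V
            y≁b : y ≁ b
            K↭ : K ↭ y ∷ K′
            y~K′ : All (y ~_) K′
            clK′ : Clique K′
            b~K′ : All (b ~_) K′

        -- Completeness of `b` to `K` would give a clique of size `w + 2`. If `b` missed both `y`
        -- and `z`, these would be the centres of a Kite with ends `a` and `x`, and `b` hanging on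
        -- `a`.
        missed-once : MissedOnce
        missed-once with all~⊎some≁ b K
        ... | inj₁ b~K = ⊥-elim (too-large (b ∷ a ∷ K) ((~-sym a~b ∷ b~K) ∷ a~K ∷ clK)
                (∈-∷⁺ʳ b∈U (∈-∷⁺ʳ a∈U K⊆U)) (cong (λ k → suc (suc k)) |K|≡w))
        ... | inj₂ (y , y∈K , b≁y) with clique-extract clK y∈K
        ...   | K′ , K↭ , y~K′ , clK′ = record
                { y≁b = ≁-sym b≁y ; K↭ = K↭ ; y~K′ = y~K′ ; clK′ = clK′
                ; b~K′ = All.tabulate λ {z} z∈ →
                    let z∈K = ∈-resp-↭ (↭-sym K↭) (there z∈) in
                    ~-byContradiction λ b≁z → kite-free (mk-Kite y z a x b
                      (All.lookup y~K′ z∈) (~-sym (All.lookup a~K y∈K)) (~-sym (All.lookup x~K y∈K))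
                      (~-sym (All.lookup a~K z∈K)) (~-sym (All.lookup x~K z∈K)) a~b
                      (≁-sym x≁a) (≁-sym b≁y) (≁-sym b≁z) x≁b) }

        open MissedOnce missed-once

        y∈K : y ∈ K
        y∈K = ∈-resp-↭ (↭-sym K↭) (here refl)
        K′⊆K : K′ ⊆ K
        K′⊆K z∈ = ∈-resp-↭ (↭-sym K↭) (there z∈)
        a~y : a ~ y
        a~y = All.lookup a~K y∈K
        x~y : x ~ y
        x~y = All.lookup x~K y∈K
        a~K′ : All (a ~_) K′
        a~K′ = All.tabulate (All.lookup a~K ∘ K′⊆K)
        |K′| : suc (length K′) ≡ w
        |K′| = trans (≡-sym (↭-length K↭)) |K|≡w

        -- K′ together with a and b is again a maximum clique, so a further vertex cannot be complete to it.
        no-triangle-ab : ∀ {c} → c ∈ U → x ≁ c → a ~ c → b ~ c → ⊥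
        no-triangle-ab {c} c∈U x≁c a~c b~c = too-large (c ∷ a ∷ b ∷ K′)
          ((~-sym a~c ∷ ~-sym b~c ∷ c~K′) ∷ (a~b ∷ a~K′) ∷ b~K′ ∷ clK′)
          (∈-∷⁺ʳ c∈U (∈-∷⁺ʳ a∈U (∈-∷⁺ʳ b∈U (K⊆U ∘ K′⊆K))))
          (cong (λ k → suc (suc k)) |K′|)
          where
          c~K′ : All (c ~_) K′
          -- A missed `z` yields a Kite with centres `a`, `b` and ends `z`, `c`, where `x` hangs on
          -- `z`.
          c~K′ = All.tabulate λ {z} z∈ → ~-byContradiction λ c≁z → kite-free (mk-Kite a b z c x
            a~b (All.lookup a~K′ z∈) a~c (All.lookup b~K′ z∈) b~c (~-sym (All.lookup x~K (K′⊆K z∈)))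
            (≁-sym c≁z) (≁-sym x≁a) (≁-sym x≁b) (≁-sym x≁c))

        -- By `no-triangle-ab`, `a` misses both `c` and `d`. This forces `c` and `d` to be complete
        -- to `K′`, and `b`, `c`, `d` with `K′` make a clique of size `w + 2`.
        no-triangle-b : ∀ {c d} → c ∈ U → d ∈ U → x ≁ c → x ≁ d → b ~ c → b ~ d → c ~ d → ⊥
        no-triangle-b {c} {d} c∈U d∈U x≁c x≁d b~c b~d c~d = too-large (b ∷ c ∷ d ∷ K′)
          ((b~c ∷ b~d ∷ b~K′) ∷ (c~d ∷ complete b~c b~d c~d x≁c x≁d a≁c a≁d) ∷
            complete b~d b~c (~-sym c~d) x≁d x≁c a≁d a≁c ∷ clK′)
          (∈-∷⁺ʳ b∈U (∈-∷⁺ʳ c∈U (∈-∷⁺ʳ d∈U (K⊆U ∘ K′⊆K))))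
          (cong (λ k → suc (suc k)) |K′|)
          where
          a≁c : a ≁ c
          a≁c = ≁-byContradiction λ a~c → no-triangle-ab c∈U x≁c a~c b~c
          a≁d : a ≁ d
          a≁d = ≁-byContradiction λ a~d → no-triangle-ab d∈U x≁d a~d b~d
          y-adjacent : ∀ {z c} → z ∈ K′ → b ~ c → a ≁ c → c ≁ z → y ~ c
          y-adjacent {z} {c} z∈ b~c a≁c c≁z = ~-byContradiction λ y≁c → kite-free (mk-Kite a z b y c
            (All.lookup a~K′ z∈) a~b a~y (~-sym (All.lookup b~K′ z∈)) (~-sym (All.lookup y~K′ z∈)) b~c
            (≁-sym y≁b) a≁c (≁-sym c≁z) y≁c)
          complete : ∀ {c d} → b ~ c → b ~ d → c ~ d → x ≁ c → x ≁ d → a ≁ c → a ≁ d → All (c ~_) K′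
          complete {c} {d} b~c b~d c~d x≁c x≁d a≁c a≁d = All.tabulate λ {z} z∈ → ~-byContradiction (excluded z∈)
            where
            excluded : ∀ {z} → z ∈ K′ → c ≁ z → ⊥
            excluded {z} z∈ c≁z with ~⊎≁ d z
            -- Centres `b`, `d`, ends `z`, `c`, with `x` hanging on `z`.
            ... | inj₁ d~z = kite-free (mk-Kite b d z c x
                    b~d (All.lookup b~K′ z∈) b~c d~z (~-sym c~d) (~-sym (All.lookup x~K (K′⊆K z∈)))
                    (≁-sym c≁z) (≁-sym x≁b) (≁-sym x≁d) (≁-sym x≁c))
            -- Since both `c` and `d` miss `z`, `y` sees both: centres `c`, `d`, ends `y`, `b`, with
            -- `x` hanging on `y`.
            ... | inj₂ d≁z = kite-free (mk-Kite c d y b x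
                    c~d (~-sym (y-adjacent z∈ b~c a≁c c≁z)) (~-sym b~c)
                    (~-sym (y-adjacent z∈ b~d a≁d d≁z)) (~-sym b~d) (~-sym x~y)
                    y≁b (≁-sym x≁c) (≁-sym x≁d) (≁-sym x≁b))

        -- First `v` sees `y`, as otherwise it is isolated from the induced path `x`, `y`, `a`, `b`.
        -- A missed `z` in `K′` then gives a Kite with centres `a`, `z` and ends `y`, `b`, where `v`
        -- hangs on `y`.
        far-complete : ∀ {v} → x ≁ v → a ≁ v → b ≁ v → All (v ~_) K
        far-complete {v} x≁v a≁v b≁v = All.tabulate λ z∈ → ~-sym (f (↭∷-split K↭ z∈))
          where
          y~v : y ~ v
          y~v = ~-byContradiction λ y≁v → p4∪k1-free (mk-P4∪K1 x y a b v
            x~y (~-sym a~y) a~b x≁a x≁b y≁b (≁-sym x≁v) (≁-sym y≁v) (≁-sym a≁v) (≁-sym b≁v))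
          f : ∀ {z} → z ≡ y ⊎ z ∈ K′ → z ~ v
          f (inj₁ refl) = y~v
          f {z} (inj₂ z∈) = ~-byContradiction λ z≁v → kite-free (mk-Kite a z y b v
            (All.lookup a~K′ z∈) a~y a~b (~-sym (All.lookup y~K′ z∈)) (~-sym (All.lookup b~K′ z∈)) y~v
            y≁b a≁v z≁v b≁v)

        -- If `c` sees both `a` and `b`, there is a forbidden triangle; if exactly one, an induced
        -- path from the other to `v` avoids all neighbours of `x`; if neither, `v` and `c` are both
        -- complete to `K`, and the clique is too large.
        far-isolated : ∀ {v c} → v ∈ U → c ∈ U → x ≁ v → x ≁ c → a ≁ v → b ≁ v → v ~ c → ⊥
        far-isolated {v} {c} v∈U c∈U x≁v x≁c a≁v b≁v v~c with ~⊎≁ a c | ~⊎≁ b c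
        ... | inj₁ a~c | inj₁ b~c = no-triangle-ab c∈U x≁c a~c b~c
        ... | inj₁ a~c | inj₂ b≁c = p4∪k1-free (mk-P4∪K1 b a c v x
                (~-sym a~b) a~c (~-sym v~c) b≁c b≁v a≁v x≁b x≁a x≁c x≁v)
        ... | inj₂ a≁c | inj₁ b~c = p4∪k1-free (mk-P4∪K1 a b c v x
                a~b b~c (~-sym v~c) a≁c a≁v b≁v x≁a x≁b x≁c x≁v)
        ... | inj₂ a≁c | inj₂ b≁c = too-large (v ∷ c ∷ K)
                ((v~c ∷ far-complete x≁v a≁v b≁v) ∷ far-complete x≁c a≁c b≁c ∷ clK)
                (∈-∷⁺ʳ v∈U (∈-∷⁺ʳ c∈U K⊆U)) (cong (λ k → suc (suc k)) |K|≡w)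

        near : ∀ {v c} → v ∈ U → c ∈ U → x ≁ v → x ≁ c → v ~ c → a ~ v ⊎ b ~ v
        near {v} v∈U c∈U x≁v x≁c v~c with ~⊎≁ a v | ~⊎≁ b v
        ... | inj₁ a~v | _ = inj₁ a~v
        ... | inj₂ _ | inj₁ b~v = inj₂ b~v
        ... | inj₂ a≁v | inj₂ b≁v = ⊥-elim (far-isolated v∈U c∈U x≁v x≁c a≁v b≁v v~c)

        -- The vertex `y` sees `x`, `a` and all of `K′`, which are `w + 1` distinct vertices; `b`
        -- tells `x` from `a`.
        degree-large : ∀ {d} → x ∈ U → DegreeBound U d → w < d
        degree-large {d} x∈U db = subst (_≤ d) (cong suc |K′|)
          (≤-trans (unique-⊆⇒length≤ unique sub) (db (K⊆U y∈K)))
          where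
          unique : Unique (x ∷ a ∷ K′)
          unique = ((λ { refl → ~×≁⇒⊥ a~b x≁b }) ∷ All.tabulate (~⇒≢ ∘ All.lookup x~K ∘ K′⊆K)) ∷
            All.map ~⇒≢ a~K′ ∷ AllPairs.map ~⇒≢ clK′
          sub : x ∷ a ∷ K′ ⊆ filter (y ~?_) U
          sub (here refl) = ∈-filter⁺ (y ~?_) x∈U (~-sym x~y)
          sub (there (here refl)) = ∈-filter⁺ (y ~?_) a∈U (~-sym a~y)
          sub (there (there v∈)) = ∈-filter⁺ (y ~?_) (K⊆U (K′⊆K v∈)) (All.lookup y~K′ v∈)

      no-triangle : ∀ {b c d e} → b ∈ U → x ≁ b → a ~ b → c ∈ U → d ∈ U → e ∈ U →
        x ≁ c → x ≁ d → x ≁ e → c ~ d → c ~ e → d ~ e → ⊥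
      no-triangle b∈U x≁b a~b c∈U d∈U e∈U x≁c x≁d x≁e c~d c~e d~e
        with near b∈U x≁b a~b c∈U d∈U x≁c x≁d c~d
           | near b∈U x≁b a~b d∈U e∈U x≁d x≁e d~e
           | near b∈U x≁b a~b e∈U c∈U x≁e x≁c (~-sym c~e)
      -- Two of the three vertices see the same one of `a` and `b`. When it is `a`, one of the two
      -- takes over the role of `b` in `no-triangle-ab`.
      ... | inj₁ a~c | inj₁ a~d | _ = no-triangle-ab c∈U x≁c a~c d∈U x≁d a~d c~d
      ... | inj₁ a~c | _ | inj₁ a~e = no-triangle-ab c∈U x≁c a~c e∈U x≁e a~e c~e
      ... | _ | inj₁ a~d | inj₁ a~e = no-triangle-ab d∈U x≁d a~d e∈U x≁e a~e d~e
      ... | inj₂ b~c | inj₂ b~d | _ = no-triangle-b b∈U x≁b a~b c∈U d∈U x≁c x≁d b~c b~d c~d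
      ... | inj₂ b~c | _ | inj₂ b~e = no-triangle-b b∈U x≁b a~b c∈U e∈U x≁c x≁e b~c b~e c~e
      ... | _ | inj₂ b~d | inj₂ b~e = no-triangle-b b∈U x≁b a~b d∈U e∈U x≁d x≁e b~d b~e d~e

    -- Covers when some maximum clique avoids the stable set.

    cover-triangle-free : ∀ {U S x w d} → CliqueBound U (suc w) →
      x ∈ U → length (filter (x ~?_) U) ≤ d → w < d →
      x ∈ S → S ⊆ U → Stable S → Dominates S U →
      (∀ {u v s} → u ∈ U → v ∈ U → s ∈ U → x ≁ u → x ≁ v → x ≁ s → u ~ v → u ~ s → v ~ s → ⊥) →
      ∃ λ k → StableCover U k × k + k ≤ 2 + (d + suc w)
    cover-triangle-free {U} {S} {x} {w} {d} cb x∈U deg≤d w<d x∈S S⊆U st dom no-triangle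
      with cover-neighbourhood cb x∈U deg≤d w<d
    -- The two extra colours are `S` and the non-neighbours `T` of `x` outside `S`.
    ... | k , coverN , bound = suc (suc k) ,
            cover-∷ st (∈⇒∈⊎∈∖ S) (cover-∷ {U′ = R} T-stable split coverN) ,
            (begin
              suc (suc k) + suc (suc k) ≡⟨ cong (2 +_) (trans (+-suc k (suc k)) (cong suc (+-suc k k))) ⟩
              3 + suc (k + k) ≤⟨ s≤s (s≤s (s≤s bound)) ⟩
              3 + (d + w) ≡⟨ cong (2 +_) (+-suc d w) ⟨
              2 + (d + suc w) ∎)
      where
      open ≤-Reasoning
      R = U ∖ S
      T = filter (x ≁?_) R
      split : ∀ {v} → v ∈ R → v ∈ T ⊎ v ∈ filter (x ~?_) U
      split {v} v∈R with ~⊎≁ x v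
      ... | inj₁ x~v = inj₂ (∈-filter⁺ (x ~?_) (proj₁ (∈∖⁻ U S v∈R)) x~v)
      ... | inj₂ x≁v = inj₁ (∈-filter⁺ (x ≁?_) v∈R x≁v)
      T⁻ : ∀ {v} → v ∈ T → v ∈ U × v ∉ S × x ≁ v
      T⁻ v∈T with ∈-filter⁻ (x ≁?_) {xs = R} v∈T
      ... | v∈R , x≁v with ∈∖⁻ U S v∈R
      ...   | v∈U , v∉S = v∈U , v∉S , x≁v
      T-stable : Stable T
      T-stable {u} {v} u∈T v∈T = ≁-byContradiction no-edge
        where
        no-edge : u ~ v → ⊥
        no-edge u~v with T⁻ u∈T | T⁻ v∈T
        -- The common neighbour in `S` of an edge of `T` is itself a non-neighbour of `x`, so it
        -- closes a triangle there.
        ... | u∈U , u∉S , x≁u | v∈U , v∉S , x≁v with common-neighbour x∈S st dom (u ∷ v ∷ [])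
                ((u~v ∷ []) ∷ [] ∷ []) (∈-∷⁺ʳ u∈U (∈-∷⁺ʳ v∈U λ ())) (x≁u ∷ x≁v ∷ []) (u∉S ∷ v∉S ∷ [])
        ...   | s , s∈S , s~u ∷ s~v ∷ [] = no-triangle u∈U v∈U (S⊆U s∈S)
                  x≁u x≁v (st x∈S s∈S) u~v (~-sym s~u) (~-sym s~v)

    -- By maximality `x` misses some `a` in `K`. If it misses `a′` too, a common neighbour `s` in
    -- `S` of the part of `K` missed by `x` must extend `K`: any other `v` in `K` missed by `s`
    -- gives a Kite with centres `a`, `a′` and ends `v`, `s`, where `x` hangs on `v`. If `x` misses
    -- only `a`, the two are exchangeable.
    cover-from-missed-clique : ∀ {U S x w d K} → CliqueBound U (suc w) → DegreeBound U d →
      x ∈ U → x ∈ S → S ⊆ U → Stable S → Dominates S U →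
      Clique K → K ⊆ U → All (_∉ S) K → length K ≡ suc w →
      ∃ λ k → StableCover U k × k + k ≤ 2 + (d + suc w)
    cover-from-missed-clique {U} {S} {x} {w} {d} {K} cb db x∈U x∈S S⊆U st dom clK K⊆U K∉S |K|
      with all~⊎some≁ x K
    ... | inj₁ x~K = ⊥-elim (1+n≰n (subst (λ k → suc k ≤ suc w) |K| (cb (x ∷ K) (x~K ∷ clK) (∈-∷⁺ʳ x∈U K⊆U))))
    ... | inj₂ (a , a∈K , x≁a) with clique-extract clK a∈K
    ...   | K′ , K↭ , a~K′ , clK′ with all~⊎some≁ x K′
    ...     | inj₂ (a′ , a′∈K′ , x≁a′) = ⊥-elim (extendable (common-neighbour x∈S st dom Q
                (AllPairs.filter⁺ (x ≁?_) clK) (K⊆U ∘ proj₁ ∘ Q⁻)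
                (All.tabulate (proj₂ ∘ Q⁻)) (All.tabulate (All.lookup K∉S ∘ proj₁ ∘ Q⁻))))
      where
      Q = filter (x ≁?_) K
      Q⁻ : ∀ {v} → v ∈ Q → v ∈ K × x ≁ v
      Q⁻ = ∈-filter⁻ (x ≁?_)
      a′∈K : a′ ∈ K
      a′∈K = ∈-resp-↭ (↭-sym K↭) (there a′∈K′)
      extendable : (∃ λ s → s ∈ S × All (s ~_) Q) → ⊥
      extendable (s , s∈S , s~Q) =
        1+n≰n (subst (λ k → suc k ≤ suc w) |K| (cb (s ∷ K) (All.tabulate s~ ∷ clK) (∈-∷⁺ʳ (S⊆U s∈S) K⊆U)))
        where
        s~Q′ : ∀ {v} → v ∈ K → x ≁ v → s ~ v
        s~Q′ v∈K x≁v = All.lookup s~Q (∈-filter⁺ (x ≁?_) v∈K x≁v)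
        x~⇒≢ : ∀ {u v} → x ≁ u → x ~ v → u ≢ v
        x~⇒≢ x≁u x~v refl = ~×≁⇒⊥ x~v x≁u
        s~ : ∀ {v} → v ∈ K → s ~ v
        s~ {v} v∈K with ~⊎≁ x v
        ... | inj₂ x≁v = s~Q′ v∈K x≁v
        ... | inj₁ x~v = ~-byContradiction λ s≁v → kite-free (mk-Kite a a′ v s x
                (All.lookup a~K′ a′∈K′) (clique-adjacent clK a∈K v∈K (x~⇒≢ x≁a x~v)) (~-sym (s~Q′ a∈K x≁a))
                (clique-adjacent clK a′∈K v∈K (x~⇒≢ x≁a′ x~v)) (~-sym (s~Q′ a′∈K x≁a′)) (~-sym x~v)
                (≁-sym s≁v) (≁-sym x≁a) (≁-sym x≁a′) (st s∈S x∈S))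
    ...     | inj₁ x~K′ with dom (K⊆U a∈K) (All.lookup K∉S a∈K)
    -- Domination supplies `b`; as `x` and `b` both lie in `S`, they are non-adjacent.
    ...       | b , b∈S , a~b = cover-triangle-free cb x∈U (db x∈U)
                  (E.degree-large (S⊆U b∈S) (st x∈S b∈S) a~b x∈U db) x∈S S⊆U st dom
                  (E.no-triangle (S⊆U b∈S) (st x∈S b∈S) a~b)
      where
      module E = ExchangeableClique cb x≁a (K⊆U a∈K) clK′ (λ v∈ → K⊆U (∈-resp-↭ (↭-sym K↭) (there v∈)))
        (suc-injective (trans (≡-sym (↭-length K↭)) |K|)) x~K′ a~K′

    -- Induction on the clique number.

    reed-cover : ∀ w U d → CliqueBound U w → DegreeBound U d →
      ∃ λ k → StableCover U k × k + k ≤ 2 + (d + w)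
    reed-cover w [] d _ _ = 0 , cover-[] , z≤n
    reed-cover zero (x ∷ U) d cb _ with cb (x ∷ []) ([] ∷ []) (∈-∷⁺ʳ (here refl) λ ())
    ... | ()
    reed-cover (suc w) U@(x ∷ U′) d cb db with maximalStable x U′
    ... | S , x∈S , S⊆U , st , dom′ with cliqueOfSize? (suc w) (U ∖ S)
    ...   | inj₁ (K , clK , K⊆R , |K|) = cover-from-missed-clique cb db (here refl) x∈S S⊆U st dom clK
              (proj₁ ∘ R⁻) (All.tabulate (proj₂ ∘ R⁻)) |K|
      where
      dom : Dominates S U
      dom (here refl) x∉S = ⊥-elim (x∉S x∈S)
      dom (there u∈) = dom′ u∈
      R⁻ : ∀ {v} → v ∈ K → v ∈ U × v ∉ S
      R⁻ = ∈∖⁻ U S ∘ K⊆R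
    ...   | inj₂ none = remove d db
      where
      R = U ∖ S
      degree-drop : ∀ {v} → v ∈ R → length (filter (v ~?_) R) < length (filter (v ~?_) U)
      degree-drop {v} v∈R with ∈∖⁻ U S v∈R
      ... | here refl , x∉S = ⊥-elim (x∉S x∈S)
      ... | there v∈U′ , v∉S with dom′ v∈U′ v∉S
      ...   | s , s∈S , v~s = length-filter-filter< (v ~?_) (_∉? S) (S⊆U s∈S) v~s (λ s∉S → s∉S s∈S)
      R⊆U : R ⊆ U
      R⊆U = proj₁ ∘ ∈∖⁻ U S
      remove : ∀ d → DegreeBound U d → ∃ λ k → StableCover U k × k + k ≤ 2 + (d + suc w)
      -- With degree bound zero nothing can be left outside `S`, since each such vertex has a
      -- neighbour in `S`.
      remove zero db = 1 , cover-∷ st (∈⇒∈⊎∈∖ S) (cover-⊆ R⊆[] cover-[]) , s≤s (s≤s z≤n)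
        where
        R⊆[] : R ⊆ []
        R⊆[] v∈R with ≤-trans (degree-drop v∈R) (db (R⊆U v∈R))
        ... | ()
      remove (suc d) db with reed-cover w R d (λ Q cl Q⊆R → s≤s⁻¹ (none Q cl Q⊆R))
                               (λ v∈R → s≤s⁻¹ (≤-trans (degree-drop v∈R) (db (R⊆U v∈R))))
      -- Both bounds have dropped by one, which pays for the two units that the class `S` adds to
      -- the doubled count.
      ... | k , coverR , bound = suc k , cover-∷ st (∈⇒∈⊎∈∖ S) coverR ,
              (begin
                suc k + suc k ≡⟨ cong suc (+-suc k k) ⟩
                2 + (k + k) ≤⟨ s≤s (s≤s bound) ⟩
                4 + (d + w) ≡⟨ cong (3 +_) (+-suc d w) ⟨
                2 + (suc d + suc w) ∎)
        where open ≤-Reasoning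

  -- From covers to colourings, and the rounded bound.

  degree≡length-filter : ∀ v → degree G v ≡ length (filter (v ~?_) (allFin n))
  degree≡length-filter v = go (allFin n)
    where
    go : ∀ L → sum (map (λ u → if adj G v u then 1 else 0) L) ≡ length (filter (v ~?_) L)
    go [] = refl
    go (u ∷ L) with adj G v u
    ... | true = cong suc (go L)
    ... | false = go L

  clique⇒HasClique : ∀ Q → Clique Q → HasClique G (length Q)
  clique⇒HasClique Q cl = lookup Q , inj , adjacent
    where
    adjacent : ∀ i j → i ≢ j → lookup Q i ~ lookup Q j
    adjacent = lookup-AllPairs ~-sym cl
    inj : Injective _≡_ _≡_ (lookup Q)
    inj {i} {j} eq with i ≟ᶠ j
    ... | yes i≡j = i≡j
    ... | no i≢j = ⊥-elim (~⇒≢ (adjacent i j i≢j) eq)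

  cover⇒colourable : ∀ {k m} → StableCover (allFin n) k → k ≤ m → Colourable G m
  cover⇒colourable {m = m} (Cs , refl , sts , cov) k≤m = colour , proper
    where
    colour : V → Fin m
    -- Among overlapping classes, the cover's own membership witness selects one. Equal colours put
    -- both ends of an edge into one stable class.
    colour v = inject≤ (Any.index (cov (∈-allFin v))) k≤m
    class : ∀ v → v ∈ lookup Cs (Any.index (cov (∈-allFin v)))
    class v = lookup-index (cov (∈-allFin v))
    proper : ProperColouring G m colour
    proper u v u~v same = ~×≁⇒⊥ u~v (All.lookup sts (∈-lookup _) (class u)
      (subst (λ i → v ∈ lookup Cs i) (≡-sym (inject≤-injective k≤m k≤m _ _ same)) (class v)))

theorem1 : ∀ {n} (G : Graph n) (ω : ℕ) →
    ¬ InducedCopy5 P4∪K1 G → ¬ InducedCopy5 Kite G →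
    IsCliqueNumber G ω →
    Colourable G ⌈ Δ G + ω + 1 /2⌉
theorem1 {n} G ω p4∪k1-free kite-free (_ , maximal)
  with reed-cover G p4∪k1-free kite-free ω (allFin n) (Δ G)
         (λ Q cl _ → maximal (length Q) (clique⇒HasClique G Q cl))
         (λ {v} v∈ → subst (_≤ Δ G) (degree≡length-filter G v) (≤-foldr-⊔ (degree G) v∈))
... | k , cover , bound = cover⇒colourable G cover
  (begin
    k ≡⟨ n≡⌊n+n/2⌋ k ⟩
    ⌊ k + k /2⌋ ≤⟨ ⌊n/2⌋-mono bound ⟩
    -- By definition `⌈ m /2⌉` is `⌊ suc m /2⌋`, so the bound with `2` under the floor is the
    -- ceiling with `1`.
    ⌊ 2 + (Δ G + ω) /2⌋ ≡⟨ cong (λ m → ⌊ suc m /2⌋) (+-comm 1 (Δ G + ω)) ⟩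
    ⌈ Δ G + ω + 1 /2⌉ ∎)
  where open ≤-Reasoning
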